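{- Let $S$ be an additively reduced and additively atomic semidomain for which $\mathcal{A}_{+}(S) = S^{\times}$. Suppose that $f \in S\llbracket x^{\pm 1} \rrbracket$ is not a Laurent polynomial, i.e., $f$ has infinite support. Then $|\mathfrak{R}(f)| \geq 2^{\aleph_0}$, where $\mathfrak{R}(f)$ is the set of all unordered triples $(g_1, g_2, g_3)$ with $f = g_1 + g_2 + g_3$ and each $g_i$ either $0$ or a multiplicative irreducible of $S\llbracket x^{\pm 1} \rrbracket$.
   Context: A semidomain is a subsemiring of an integral domain, i.e., a subset $S$ of an integral domain containing $0$ and $1$ and closed under addition and multiplication. $S^{\times}$ denotes the group of units of the multiplicative monoid $S^* = S\setminus\{0\}$ (elements having a multiplicative inverse in $S$). $\mathcal{A}_{+}(S)$ is the set of atoms of the additive monoid $(S,+)$: elements $a$ that are not additively invertible in $S$ and such that $a = b + c$ with $b, c \in S$ implies that $b$ or $c$ is additively invertible in $S$. $S$ is additively reduced if $0$ is the only invertible element of $(S,+)$. $S$ is additively atomic if every non-invertible element of $(S,+)$ is a sum of finitely many atoms of $(S,+)$. $S\llbracket x^{\pm 1} \rrbracket$ is the semidomain of formal Laurent series with coefficients in $S$ and only finitely many terms with negative exponent; the support of $f$ is the set of exponents of $f$ with nonzero coefficient. A multiplicative irreducible of a semidomain $T$ is a nonzero non-unit $a \in T$ such that $a = bc$ with $b, c \in T$ implies $b \in T^{\times}$ or $c \in T^{\times}$. Unordered triples are multisets of size three. -}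

module Defs where

open import Algebra.Bundles using (CommutativeRing; CommutativeSemiring; RawSemiring)
import Algebra.Definitions.RawSemiring as RawSemiringDefs
import Algebra.Properties.Monoid.Sum as MonoidSum
open import Data.Fin.Base using (toℕ)
open import Data.Integer.Base as ℤ using (ℤ; +_; -[1+_])
import Data.Integer.Properties as ℤₚ
open import Data.Integer.Tactic.RingSolver using (solve-∀)
open import Data.List.Base using (List; []; _∷_)
open import Data.List.Membership.Propositional using (_∈_)
import Data.List.Relation.Binary.Permutation.Setoid as Permutation
open import Data.Nat.Base as ℕ using (ℕ; suc)
import Data.Nat.Properties as ℕₚ
open import Data.Product.Base using (Σ; ∃-syntax; _×_; _,_; proj₁; proj₂)
open import Data.Sum.Base using (_⊎_)
open import Data.Vec.Functional using (Vector)
open import Level using (Level; _⊔_) renaming (suc to lsuc)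
open import Relation.Binary.Bundles using (Setoid)
open import Relation.Binary.PropositionalEquality as ≡ using (_≡_)
open import Relation.Nullary.Negation.Core using (¬_)
open import Relation.Unary using (Pred)

private
  variable
    c ℓ p : Level

  cancel : ∀ i j → ℤ.- (i ℤ.+ j) ℤ.+ ℤ.- (+ 0 ℤ.- i) ≡ ℤ.- j
  cancel = solve-∀

record IntegralDomain c ℓ : Set (lsuc (c ⊔ ℓ)) where
  field
    commutativeRing : CommutativeRing c ℓ
  open CommutativeRing commutativeRing public
  field
    1≉0            : ¬ (1# ≈ 0#)
    noZeroDivisors : ∀ x y → x * y ≈ 0# → x ≈ 0# ⊎ y ≈ 0#

record Semidomain c ℓ p : Set (lsuc (c ⊔ ℓ ⊔ p)) where
  field
    domain : IntegralDomain c ℓ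
  private module D = IntegralDomain domain
  field
    Member   : Pred D.Carrier p
    resp     : ∀ {x y} → x D.≈ y → Member x → Member y
    0-member : Member D.0#
    1-member : Member D.1#
    +-closed : ∀ {x y} → Member x → Member y → Member (x D.+ y)
    *-closed : ∀ {x y} → Member x → Member y → Member (x D.* y)

  commutativeSemiring : CommutativeSemiring (c ⊔ p) ℓ
  commutativeSemiring = record
    { Carrier = Σ D.Carrier Member
    ; _≈_     = λ x y → proj₁ x D.≈ proj₁ y
    ; _+_     = λ (x , x∈S) (y , y∈S) → x D.+ y , +-closed x∈S y∈S
    ; _*_     = λ (x , x∈S) (y , y∈S) → x D.* y , *-closed x∈S y∈S
    ; 0#      = D.0# , 0-member
    ; 1#      = D.1# , 1-member
    ; isCommutativeSemiring = record
      { isSemiring = record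
        { isSemiringWithoutAnnihilatingZero = record
          { +-isCommutativeMonoid = record
            { isMonoid = record
              { isSemigroup = record
                { isMagma = record
                  { isEquivalence = record
                    { refl = D.refl ; sym = D.sym ; trans = D.trans }
                  ; ∙-cong = D.+-cong
                  }
                ; assoc = λ _ _ _ → D.+-assoc _ _ _
                }
              ; identity = (λ _ → D.+-identityˡ _) , (λ _ → D.+-identityʳ _)
              }
            ; comm = λ _ _ → D.+-comm _ _
            }
          ; *-cong     = D.*-cong
          ; *-assoc    = λ _ _ _ → D.*-assoc _ _ _
          ; *-identity = (λ _ → D.*-identityˡ _) , (λ _ → D.*-identityʳ _)
          ; distrib    = (λ _ _ _ → D.distribˡ _ _ _) , (λ _ _ _ → D.distribʳ _ _ _)
          }
        ; zero = (λ _ → D.zeroˡ _) , (λ _ → D.zeroʳ _)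
        }
      ; *-comm = λ _ _ → D.*-comm _ _
      }
    }

  open CommutativeSemiring commutativeSemiring public using (rawSemiring)

module _ (R : RawSemiring c ℓ) where
  open RawSemiring R
  open RawSemiringDefs R using (_∣_; sum; Irreducible)

  Unit : Pred Carrier (c ⊔ ℓ)
  Unit x = x ∣ 1#

  AdditivelyInvertible : Pred Carrier (c ⊔ ℓ)
  AdditivelyInvertible x = ∃[ y ] x + y ≈ 0#

  record AdditiveAtom (a : Carrier) : Set (c ⊔ ℓ) where
    field
      ¬invertible : ¬ AdditivelyInvertible a
      split       : ∀ x y → a ≈ x + y → AdditivelyInvertible x ⊎ AdditivelyInvertible y

  AdditivelyReduced : Set (c ⊔ ℓ)
  AdditivelyReduced = ∀ x → AdditivelyInvertible x → x ≈ 0#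

  AdditivelyAtomic : Set (c ⊔ ℓ)
  AdditivelyAtomic =
    ∀ x → ¬ AdditivelyInvertible x →
    ∃[ n ] Σ (Vector Carrier n) λ as → (∀ i → AdditiveAtom (as i)) × x ≈ sum as

  -- The library's `Irreducible` does not itself ask for the element to be nonzero.
  MultiplicativeIrreducible : Pred Carrier (c ⊔ ℓ)
  MultiplicativeIrreducible x = ¬ (x ≈ 0#) × Irreducible x

module Laurent (R : CommutativeSemiring c ℓ) where
  open CommutativeSemiring R
  open MonoidSum +-monoid using (sum; sum-cong-≋; sum-replicate-zero)

  -- Having finitely many terms with negative exponent is recorded as a lower
  -- bound on the exponents. The bound need not be sharp, and `_≋_` ignores it.
  record LaurentSeries : Set (c ⊔ ℓ) where
    field
      coeff  : ℤ → Carrier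
      depth  : ℕ
      vanish : ∀ n → n ℤ.< ℤ.- (+ depth) → coeff n ≈ 0#

  open LaurentSeries public

  infix 4 _≋_
  _≋_ : LaurentSeries → LaurentSeries → Set ℓ
  f ≋ g = ∀ n → coeff f n ≈ coeff g n

  0ₗ : LaurentSeries
  0ₗ = record { coeff = λ _ → 0# ; depth = 0 ; vanish = λ _ _ → refl }

  1ₗ : LaurentSeries
  1ₗ = record { coeff = δ ; depth = 0 ; vanish = δ-vanish }
    where
    δ : ℤ → Carrier
    δ (+ 0)     = 1#
    δ (+ suc _) = 0#
    δ -[1+ _ ]  = 0#

    δ-vanish : ∀ n → n ℤ.< + 0 → δ n ≈ 0#
    δ-vanish (+ _)    (ℤ.+<+ ())
    δ-vanish -[1+ _ ] _ = refl

  infixl 6 _+ₗ_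
  _+ₗ_ : LaurentSeries → LaurentSeries → LaurentSeries
  f +ₗ g = record
    { coeff  = λ n → coeff f n + coeff g n
    ; depth  = d
    ; vanish = λ n n<-d → trans
        (+-cong (vanish f n (ℤₚ.<-≤-trans n<-d (ℤₚ.neg-mono-≤ (ℤ.+≤+ (ℕₚ.m≤m⊔n _ _)))))
                (vanish g n (ℤₚ.<-≤-trans n<-d (ℤₚ.neg-mono-≤ (ℤ.+≤+ (ℕₚ.m≤n⊔m _ _))))))
        (+-identityˡ 0#)
    }
    where d = depth f ℕ.⊔ depth g

  -- In Σ_{i+j=n} fᵢ gⱼ only the indices - depth f ≤ i ≤ n + depth g contribute;
  -- they are i = k - depth f with 0 ≤ k ≤ n + depth f + depth g. When that upper
  -- end is negative, the absolute value below only adds terms that vanish.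
  termCount : LaurentSeries → LaurentSeries → ℤ → ℕ
  termCount f g n = suc ℤ.∣ n ℤ.+ + depth f ℤ.+ + depth g ∣

  termIndex : LaurentSeries → ℕ → ℤ
  termIndex f k = + k ℤ.- + depth f

  terms : ∀ f g n → Vector Carrier (termCount f g n)
  terms f g n k = coeff f (termIndex f (toℕ k)) * coeff g (n ℤ.- termIndex f (toℕ k))

  infixl 7 _*ₗ_
  _*ₗ_ : LaurentSeries → LaurentSeries → LaurentSeries
  f *ₗ g = record
    { coeff  = λ n → sum (terms f g n)
    ; depth  = depth f ℕ.+ depth g
    ; vanish = λ n n<-d → trans
        (sum-cong-≋ {termCount f g n} {terms f g n} {λ _ → 0#} (λ k →
          trans (*-congˡ (vanish g _ (below n (toℕ k) n<-d))) (zeroʳ _)))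
        (sum-replicate-zero (termCount f g n))
    }
    where
    below : ∀ n k → n ℤ.< ℤ.- (+ (depth f ℕ.+ depth g)) →
            n ℤ.- termIndex f k ℤ.< ℤ.- (+ depth g)
    below n k n<-d = ≡.subst (n ℤ.- termIndex f k ℤ.<_) (cancel (+ depth f) (+ depth g))
      (ℤₚ.+-mono-<-≤ n<-d (ℤₚ.neg-mono-≤ (ℤₚ.+-monoˡ-≤ (ℤ.- (+ depth f)) (ℤ.+≤+ (ℕ.z≤n {k})))))

  laurentSetoid : Setoid (c ⊔ ℓ) ℓ
  laurentSetoid = record
    { Carrier       = LaurentSeries
    ; _≈_           = _≋_
    ; isEquivalence = record
      { refl  = λ _ → refl
      ; sym   = λ f≋g n → sym (f≋g n)
      ; trans = λ f≋g g≋h n → trans (f≋g n) (g≋h n)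
      }
    }

  laurentRawSemiring : RawSemiring (c ⊔ ℓ) ℓ
  laurentRawSemiring = record
    { Carrier = LaurentSeries
    ; _≈_     = _≋_
    ; _+_     = _+ₗ_
    ; _*_     = _*ₗ_
    ; 0#      = 0ₗ
    ; 1#      = 1ₗ
    }

  Support : LaurentSeries → Pred ℤ ℓ
  Support f n = ¬ (coeff f n ≈ 0#)

  InfiniteSupport : LaurentSeries → Set ℓ
  InfiniteSupport f = ¬ (∃[ ns ] ∀ n → Support f n → n ∈ ns)

  ZeroOrIrreducible : Pred LaurentSeries (c ⊔ ℓ)
  ZeroOrIrreducible g = g ≋ 0ₗ ⊎ MultiplicativeIrreducible laurentRawSemiring g

  record Decomposition (f : LaurentSeries) : Set (c ⊔ ℓ) where
    field
      g₁ g₂ g₃ : LaurentSeries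
      sum-≋    : f ≋ g₁ +ₗ g₂ +ₗ g₃
      adm₁     : ZeroOrIrreducible g₁
      adm₂     : ZeroOrIrreducible g₂
      adm₃     : ZeroOrIrreducible g₃

    triple : List LaurentSeries
    triple = g₁ ∷ g₂ ∷ g₃ ∷ []

  -- Unordered triples: two decompositions are identified when their triples
  -- agree up to reordering (and equality of series).
  ℜ : LaurentSeries → Setoid (c ⊔ ℓ) (c ⊔ ℓ)
  ℜ f = record
    { Carrier       = Decomposition f
    ; _≈_           = λ d e → triple d ↭ triple e
    ; isEquivalence = record { refl = ↭-refl ; sym = ↭-sym ; trans = ↭-trans }
    }
    where
    open Permutation laurentSetoid
    open Decomposition

-- Addition in S has no cancellation to zero, so supp (g h) = supp g + supp h. Call
-- an exponent a of g isolated if all other exponents are far below a / 2 or far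
-- above a. If supp g has arbitrarily large, arbitrarily well isolated exponents
-- and supp g = B + C, write such an exponent as a = i + j with, say, j ≤ i; every
-- c ∈ C gives an exponent i + c near a, so i + c = a and C = {j}. Hence one factor
-- of g is a monomial, and it is a unit as soon as g has a unit coefficient.
--
-- Every nonzero coefficient of f is a unit plus a remainder. Cut the exponents of f
-- into rapidly growing blocks, each with a centre far above everything before its
-- block, and give all of a block but its centre to the same one of g₁ and g₂. When
-- the other one receives the centre (or at least its unit part), the centre is
-- isolated there. Infinitely many centres isolate in g₁, infinitely many in g₂, and
-- infinitely many are left free to record a binary sequence; g₃ = 0.

module Submission where

open import Algebra.Bundles using (AbelianGroup; CommutativeSemiring)
open import Algebra.Definitions.RawMagma using (_,_)
import Algebra.Definitions.RawSemiring as RawSemiringDefs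
import Algebra.Properties.CommutativeMonoid.Sum as CommutativeMonoidSum
import Algebra.Properties.Group as GroupProperties
open import Axiom.ExcludedMiddle using (ExcludedMiddle)
open import Data.Bool.Base using (Bool; true; false; not; if_then_else_)
open import Data.Empty using (⊥; ⊥-elim)
open import Data.Fin.Base using (Fin; toℕ; fromℕ<)
import Data.Fin.Properties as Finₚ
open import Data.Integer.Base as ℤ using (ℤ; +_; -[1+_])
import Data.Integer.Properties as ℤₚ
open import Data.Integer.Tactic.RingSolver using (solve-∀)
open import Data.List.Base using ([]; _∷_; map; upTo)
open import Data.List.Membership.Propositional using (_∈_)
open import Data.List.Membership.Propositional.Properties using (∈-map⁺; ∈-upTo⁺)
import Data.List.Relation.Binary.Permutation.Setoid as Permutation
import Data.List.Relation.Binary.Permutation.Setoid.Properties as Permₚ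
open import Data.List.Relation.Binary.Pointwise.Base using ([]; _∷_)
open import Data.List.Relation.Unary.Any using (here; there)
open import Data.Nat.Base as ℕ using (ℕ; zero; suc)
import Data.Nat.Properties as ℕₚ
open import Data.Product.Base using (Σ; ∃-syntax; _×_; _,_; proj₁; proj₂)
open import Data.Sum.Base using (_⊎_; inj₁; inj₂; [_,_]′)
open import Data.Vec.Functional using (Vector; tail)
open import Function.Base using (_∘_; case_of_)
open import Function.Bundles using (Injection)
open import Level using (_⊔_)
open import Relation.Binary.Definitions using (tri<; tri≈; tri>)
open import Relation.Binary.PropositionalEquality as ≡ using (_≡_; _≢_; _→-setoid_)
open import Relation.Nullary using (yes; no; does; ¬_; contradiction)
open import Relation.Nullary.Decidable using (decidable-stable; dec-true; dec-false)
open import Relation.Unary using (Pred; _≐_)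
open import Defs

-- Sets of integers with isolated elements, and their sumsets.

private

  Isolated : ∀ {a} → Pred ℤ a → ℕ → ℤ → Set a
  Isolated A N a = A a × (∀ a' → A a' → a' ≡ a ⊎ a' ℤ.+ a' ℤ.+ + N ℤ.< a ⊎ a ℤ.+ + N ℤ.< a')

  Lacunary : ∀ {a} → Pred ℤ a → Set a
  Lacunary A = ∀ N → ∃[ a ] + N ℤ.≤ a × Isolated A N a

  open GroupProperties (AbelianGroup.group ℤₚ.+-0-abelianGroup) using () renaming (∙-cancelˡ to ℤ-+-cancelˡ)

  i+j-i≡j : ∀ i j → i ℤ.+ j ℤ.- i ≡ j
  i+j-i≡j = solve-∀

  i+j-j≡i : ∀ i j → i ℤ.+ j ℤ.- j ≡ i
  i+j-j≡i = solve-∀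

  i-j+j≡i : ∀ i j → i ℤ.- j ℤ.+ j ≡ i
  i-j+j≡i = solve-∀

  i+[j-i]≡j : ∀ i j → i ℤ.+ (j ℤ.- i) ≡ j
  i+[j-i]≡j = solve-∀

  j-[j-i]≡i : ∀ i j → j ℤ.- (j ℤ.- i) ≡ i
  j-[j-i]≡i = solve-∀

  ∣i∣≤∣i+j∣ : ∀ {i j} → + 0 ℤ.≤ i → + 0 ℤ.≤ j → ℤ.∣ i ∣ ℕ.≤ ℤ.∣ i ℤ.+ j ∣
  ∣i∣≤∣i+j∣ (ℤ.+≤+ {n = m} _) (ℤ.+≤+ {n = n} _) = ℕₚ.m≤m+n m n

  i≤+∣i∣ : ∀ i → i ℤ.≤ + ℤ.∣ i ∣
  i≤+∣i∣ (+ n)    = ℤₚ.≤-refl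
  i≤+∣i∣ -[1+ n ] = ℤ.-≤+

  module _ {a} {A : Pred ℤ a} (K : ℕ) where

    -- Twice `i + k` plus `2K` is at least `2i`, hence at least `i + j`, so `i + k` is not far
    -- below. Since `k` exceeds `j` by at most `2K`, it is not far above either. Isolation leaves
    -- only `i + k = i + j`.
    isolated-summand : ∀ {i j k} → Isolated A (K ℕ.+ K) (i ℤ.+ j) → j ℤ.≤ i →
      ℤ.- (+ K) ℤ.≤ j → ℤ.- (+ K) ℤ.≤ k → k ℤ.≤ + K → A (i ℤ.+ k) → k ≡ j
    isolated-summand {i} {j} {k} (_ , isolated) j≤i -K≤j -K≤k k≤K i+k∈A with isolated _ i+k∈A
    ... | inj₁ i+k≡i+j = ≡.trans (≡.sym (i+j-i≡j i k)) (≡.trans (≡.cong (ℤ._- i) i+k≡i+j) (i+j-i≡j i j))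
    ... | inj₂ (inj₁ below) = contradiction below (ℤₚ.≤⇒≯ (begin
      i ℤ.+ j                                          ≤⟨ ℤₚ.+-monoʳ-≤ i j≤i ⟩
      i ℤ.+ i                                          ≡⟨ expand i (+ K) ⟩
      i ℤ.+ ℤ.- + K ℤ.+ (i ℤ.+ ℤ.- + K) ℤ.+ (+ K ℤ.+ + K)
        ≤⟨ ℤₚ.+-monoˡ-≤ (+ K ℤ.+ + K) (ℤₚ.+-mono-≤ (ℤₚ.+-monoʳ-≤ i -K≤k) (ℤₚ.+-monoʳ-≤ i -K≤k)) ⟩
      i ℤ.+ k ℤ.+ (i ℤ.+ k) ℤ.+ + (K ℕ.+ K)            ∎))
      where
      open ℤₚ.≤-Reasoning
      expand : ∀ i K → i ℤ.+ i ≡ i ℤ.+ ℤ.- K ℤ.+ (i ℤ.+ ℤ.- K) ℤ.+ (K ℤ.+ K)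
      expand = solve-∀
    ... | inj₂ (inj₂ above) = contradiction above (ℤₚ.≤⇒≯ (begin
      i ℤ.+ k                                 ≤⟨ ℤₚ.+-monoʳ-≤ i k≤K ⟩
      i ℤ.+ + K                               ≡⟨ expand i (+ K) ⟩
      i ℤ.+ ℤ.- + K ℤ.+ (+ K ℤ.+ + K)         ≤⟨ ℤₚ.+-monoˡ-≤ (+ K ℤ.+ + K) (ℤₚ.+-monoʳ-≤ i -K≤j) ⟩
      i ℤ.+ j ℤ.+ + (K ℕ.+ K)                 ∎))
      where
      open ℤₚ.≤-Reasoning
      expand : ∀ i K → i ℤ.+ K ≡ i ℤ.+ ℤ.- K ℤ.+ (K ℤ.+ K)
      expand = solve-∀

  -- Write a sufficiently isolated element as `i + j`. The larger summand forces the two given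
  -- elements of the other set to coincide with the smaller one.
  lacunary-sumset : ∀ {a b c} {A : Pred ℤ a} {B : Pred ℤ b} {C : Pred ℤ c} → Lacunary A →
    (∀ n → A n → ∃[ i ] ∃[ j ] B i × C j × i ℤ.+ j ≡ n) →
    (∀ i j → B i → C j → A (i ℤ.+ j)) →
    ∀ d → (∀ i → B i → ℤ.- (+ d) ℤ.≤ i) → (∀ i → C i → ℤ.- (+ d) ℤ.≤ i) →
    ∀ {b₁ b₂ c₁ c₂} → B b₁ → B b₂ → b₁ ≢ b₂ → C c₁ → C c₂ → c₁ ≢ c₂ → ⊥
  lacunary-sumset {A = A} {B} {C} lacunary split join d B-bounded C-bounded
    {b₁} {b₂} {c₁} {c₂} b₁∈B b₂∈B b₁≢b₂ c₁∈C c₂∈C c₁≢c₂ =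
    case lacunary (K ℕ.+ K) of λ where
      (a , _ , isolated) → case split a (proj₁ isolated) of λ where
        (i , j , i∈B , j∈C , ≡.refl) → case ℤₚ.≤-total j i of λ where
          (inj₁ j≤i) → c₁≢c₂ (≡.trans
            (isolated-summand K isolated j≤i (C≥ j j∈C) (C≥ c₁ c₁∈C) c₁≤K (join i c₁ i∈B c₁∈C))
            (≡.sym (isolated-summand K isolated j≤i (C≥ j j∈C) (C≥ c₂ c₂∈C) c₂≤K (join i c₂ i∈B c₂∈C))))
          (inj₂ i≤j) → let isolated′ = ≡.subst (Isolated A _) (ℤₚ.+-comm i j) isolated in b₁≢b₂ (≡.trans
            (isolated-summand K isolated′ i≤j (B≥ i i∈B) (B≥ b₁ b₁∈B) b₁≤K (swap b₁ j (join b₁ j b₁∈B j∈C)))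
            (≡.sym (isolated-summand K isolated′ i≤j (B≥ i i∈B) (B≥ b₂ b₂∈B) b₂≤K (swap b₂ j (join b₂ j b₂∈B j∈C)))))
    where
    -- `K` bounds the four given elements from above and, through `d`, both sets from below.
    K₁ = ℤ.∣ b₁ ∣ ℕ.+ ℤ.∣ b₂ ∣
    K₂ = ℤ.∣ c₁ ∣ ℕ.+ ℤ.∣ c₂ ∣
    K  = d ℕ.+ (K₁ ℕ.+ K₂)

    swap : ∀ i j → A (i ℤ.+ j) → A (j ℤ.+ i)
    swap i j = ≡.subst A (ℤₚ.+-comm i j)

    weaken : ∀ {i} → ℤ.- (+ d) ℤ.≤ i → ℤ.- (+ K) ℤ.≤ i
    weaken = ℤₚ.≤-trans (ℤₚ.neg-mono-≤ (ℤ.+≤+ (ℕₚ.m≤m+n d _)))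

    B≥ : ∀ i → B i → ℤ.- (+ K) ℤ.≤ i
    B≥ i = weaken ∘ B-bounded i

    C≥ : ∀ i → C i → ℤ.- (+ K) ℤ.≤ i
    C≥ i = weaken ∘ C-bounded i

    K₁≤K : K₁ ℕ.≤ K
    K₁≤K = ℕₚ.≤-trans (ℕₚ.m≤m+n K₁ K₂) (ℕₚ.m≤n+m _ d)

    K₂≤K : K₂ ℕ.≤ K
    K₂≤K = ℕₚ.≤-trans (ℕₚ.m≤n+m K₂ K₁) (ℕₚ.m≤n+m _ d)

    b₁≤K : b₁ ℤ.≤ + K
    b₁≤K = ℤₚ.≤-trans (i≤+∣i∣ b₁) (ℤ.+≤+ (ℕₚ.≤-trans (ℕₚ.m≤m+n _ _) K₁≤K))

    b₂≤K : b₂ ℤ.≤ + K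
    b₂≤K = ℤₚ.≤-trans (i≤+∣i∣ b₂) (ℤ.+≤+ (ℕₚ.≤-trans (ℕₚ.m≤n+m _ ℤ.∣ b₁ ∣) K₁≤K))

    c₁≤K : c₁ ℤ.≤ + K
    c₁≤K = ℤₚ.≤-trans (i≤+∣i∣ c₁) (ℤ.+≤+ (ℕₚ.≤-trans (ℕₚ.m≤m+n _ _) K₂≤K))

    c₂≤K : c₂ ℤ.≤ + K
    c₂≤K = ℤₚ.≤-trans (i≤+∣i∣ c₂) (ℤ.+≤+ (ℕₚ.≤-trans (ℕₚ.m≤n+m _ ℤ.∣ c₁ ∣) K₂≤K))

-- Conditions on the coefficient semiring.

module _ {c ℓ} (R : CommutativeSemiring c ℓ) where
  open CommutativeSemiring R

  Nontrivial : Set ℓ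
  Nontrivial = ¬ 1# ≈ 0#

  NoZeroDivisors : Set (c ⊔ ℓ)
  NoZeroDivisors = ∀ x y → x * y ≈ 0# → x ≈ 0# ⊎ y ≈ 0#

  -- The form in which additive atomicity and the equality of atoms and units enter the
  -- construction.
  UnitSummands : Set (c ⊔ ℓ)
  UnitSummands = ∀ x → ¬ x ≈ 0# → ∃[ u ] ∃[ r ] Unit rawSemiring u × x ≈ u + r

-- Supports of products, and irreducibility of series with lacunary support.

module LaurentFactorisation
  (em : ∀ {a} → ExcludedMiddle a) {c ℓ} (R : CommutativeSemiring c ℓ)
  (1≉0 : Nontrivial R) (reduced : AdditivelyReduced (CommutativeSemiring.rawSemiring R))
  (noZeroDivisors : NoZeroDivisors R)
  where

  open CommutativeSemiring R
  open Laurent R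
  open CommutativeMonoidSum +-commutativeMonoid using (sum; sum-cong-≋; sum-replicate-zero; sum-remove)
  open import Relation.Binary.Reasoning.Setoid setoid

  ≈-stable : ∀ {x y} → ¬ ¬ x ≈ y → x ≈ y
  ≈-stable = decidable-stable em

  sum-zero : ∀ {n} (t : Vector Carrier n) → (∀ k → t k ≈ 0#) → sum t ≈ 0#
  sum-zero {n} t t≈0 = trans (sum-cong-≋ t≈0) (sum-replicate-zero n)

  sum-single : ∀ {n} (t : Vector Carrier n) i → (∀ k → k ≢ i → t k ≈ 0#) → sum t ≈ t i
  sum-single {suc n} t i t≈0 = begin
    sum t     ≈⟨ sum-remove {i = i} t ⟩
    t i + _   ≈⟨ +-congˡ (sum-zero _ λ k → t≈0 _ (Finₚ.punchInᵢ≢i i k)) ⟩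
    t i + 0#  ≈⟨ +-identityʳ _ ⟩
    t i       ∎

  -- The remaining terms add up to an additive inverse of `t i`.
  sum≈0⇒≈0 : ∀ {n} (t : Vector Carrier n) → sum t ≈ 0# → ∀ i → t i ≈ 0#
  sum≈0⇒≈0 {suc n} t ∑t≈0 i = reduced (t i) (_ , trans (sym (sum-remove t)) ∑t≈0)

  coeff-cong : ∀ g {i j} → i ≡ j → coeff g i ≈ coeff g j
  coeff-cong g ≡.refl = refl

  Support⇒≥ : ∀ g i → Support g i → ℤ.- (+ depth g) ℤ.≤ i
  Support⇒≥ g i i∈g = ℤₚ.≮⇒≥ (i∈g ∘ vanish g i)

  Support⇒nonNeg : ∀ g i → Support g i → + 0 ℤ.≤ i ℤ.+ + depth g
  Support⇒nonNeg g i i∈g = ≡.subst (ℤ._≤ i ℤ.+ + depth g) (ℤₚ.+-inverseˡ (+ depth g))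
    (ℤₚ.+-monoˡ-≤ (+ depth g) (Support⇒≥ g i i∈g))

  termIndex-surjective : ∀ g i → Support g i → termIndex g ℤ.∣ i ℤ.+ + depth g ∣ ≡ i
  termIndex-surjective g i i∈g = ≡.trans
    (≡.cong (ℤ._- + depth g) (ℤₚ.0≤i⇒+∣i∣≡i (Support⇒nonNeg g i i∈g))) (i+j-j≡i i (+ depth g))

  termIndex-injective : ∀ g {k l} → termIndex g k ≡ termIndex g l → k ≡ l
  termIndex-injective g {k} {l} eq = ℤₚ.+-injective (≡.trans (≡.sym (i-j+j≡i (+ k) (+ depth g)))
    (≡.trans (≡.cong (ℤ._+ + depth g) eq) (i-j+j≡i (+ l) (+ depth g))))

  -- The finite window of summation misses no nonzero term: `i + depth g` and `n - i + depth h` are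
  -- nonnegative with sum `n + depth g + depth h`, so the first is a valid index.
  term-at : ∀ g h n i → Support g i → Support h (n ℤ.- i) →
            Σ (Fin (termCount g h n)) λ k → termIndex g (toℕ k) ≡ i
  term-at g h n i i∈g n-i∈h = fromℕ< k< ,
    ≡.trans (≡.cong (termIndex g) (Finₚ.toℕ-fromℕ< k<)) (termIndex-surjective g i i∈g)
    where
    regroup : ∀ n i d e → i ℤ.+ d ℤ.+ (n ℤ.- i ℤ.+ e) ≡ n ℤ.+ d ℤ.+ e
    regroup = solve-∀
    k< : ℤ.∣ i ℤ.+ + depth g ∣ ℕ.< termCount g h n
    k< = ℕ.s≤s (≡.subst (λ m → _ ℕ.≤ ℤ.∣ m ∣) (regroup n i (+ depth g) (+ depth h))
      (∣i∣≤∣i+j∣ (Support⇒nonNeg g i i∈g) (Support⇒nonNeg h _ n-i∈h)))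

  *-nonzero : ∀ {x y} → ¬ x ≈ 0# → ¬ y ≈ 0# → ¬ x * y ≈ 0#
  *-nonzero x≉0 y≉0 = [ x≉0 , y≉0 ]′ ∘ noZeroDivisors _ _

  term-cong : ∀ g h n {i j} → i ≡ j → coeff g i * coeff h (n ℤ.- i) ≈ coeff g j * coeff h (n ℤ.- j)
  term-cong g h n ≡.refl = refl

  -- One term of the coefficient is nonzero for lack of zero divisors, and the others cannot cancel
  -- it.
  support-*⁺ : ∀ g h i j → Support g i → Support h j → Support (g *ₗ h) (i ℤ.+ j)
  support-*⁺ g h i j i∈g j∈h gh≈0 = case term-at g h (i ℤ.+ j) i i∈g j′∈h of λ where
      (k , k≡i) → *-nonzero i∈g j′∈h
        (trans (term-cong g h (i ℤ.+ j) (≡.sym k≡i)) (sum≈0⇒≈0 (terms g h (i ℤ.+ j)) gh≈0 k))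
    where
    j′∈h : Support h (i ℤ.+ j ℤ.- i)
    j′∈h = j∈h ∘ trans (coeff-cong h (≡.sym (i+j-i≡j i j)))

  support-*⁻ : ∀ g h n → Support (g *ₗ h) n → ∃[ i ] ∃[ j ] Support g i × Support h j × i ℤ.+ j ≡ n
  support-*⁻ g h n n∈gh = decidable-stable em λ none → n∈gh (sum-zero (terms g h n) λ k → ≈-stable λ term≉0 →
    none (termIndex g (toℕ k) , _ ,
      (λ g≈0 → term≉0 (trans (*-congʳ g≈0) (zeroˡ _))) ,
      (λ h≈0 → term≉0 (trans (*-congˡ h≈0) (zeroʳ _))) , i+[j-i]≡j (termIndex g (toℕ k)) n))

  coeff-*-single : ∀ g h n i → (∀ j → j ≢ i → coeff g j * coeff h (n ℤ.- j) ≈ 0#) →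
                   coeff (g *ₗ h) n ≈ coeff g i * coeff h (n ℤ.- i)
  -- If the term at `i` is zero, `i` may lie outside the window of summation; otherwise `term-at`
  -- finds it there.
  coeff-*-single g h n i others≈0 with em {P = coeff g i * coeff h (n ℤ.- i) ≈ 0#}
  ... | yes term≈0 = trans (sum-zero (terms g h n) λ k → case termIndex g (toℕ k) ℤₚ.≟ i of λ where
          (yes k≡i) → trans (term-cong g h n k≡i) term≈0
          (no k≢i)  → others≈0 _ k≢i) (sym term≈0)
  ... | no term≉0 with term-at g h n i (λ g≈0 → term≉0 (trans (*-congʳ g≈0) (zeroˡ _)))
                                       (λ h≈0 → term≉0 (trans (*-congˡ h≈0) (zeroʳ _)))
  ... | k , k≡i = trans
          (sum-single (terms g h n) k λ l l≢k → others≈0 _ λ l≡i →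
            l≢k (Finₚ.toℕ-injective (termIndex-injective g (≡.trans l≡i (≡.sym k≡i)))))
          (term-cong g h n k≡i)

  ConcentratedAt : ℤ → LaurentSeries → Set ℓ
  ConcentratedAt i g = ∀ j → j ≢ i → coeff g j ≈ 0#

  δ : ℤ → Carrier → ℤ → Carrier
  δ i x j = if does (j ℤₚ.≟ i) then x else 0#

  δ-off : ∀ i x j → j ≢ i → δ i x j ≈ 0#
  δ-off i x j j≢i = reflexive (≡.cong (if_then x else 0#) (dec-false (j ℤₚ.≟ i) j≢i))

  monomial : ℤ → Carrier → LaurentSeries
  monomial i x = record
    { coeff  = δ i x
    ; depth  = ℤ.∣ i ∣
    ; vanish = λ j j<-d → δ-off i x j λ j≡i → ℤₚ.<⇒≱ j<-d (≡.subst (_ ℤ.≤_) (≡.sym j≡i) (-∣i∣≤i i))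
    }
    where
    -∣i∣≤i : ∀ i → ℤ.- (+ ℤ.∣ i ∣) ℤ.≤ i
    -∣i∣≤i (+ n)    = ℤₚ.neg-≤-pos {n}
    -∣i∣≤i -[1+ n ] = ℤₚ.≤-refl

  coeff-monomial : ∀ i x → coeff (monomial i x) i ≈ x
  coeff-monomial i x = reflexive (≡.cong (if_then x else 0#) (dec-true (i ℤₚ.≟ i) ≡.refl))

  1ₗ-concentrated : ConcentratedAt (+ 0) 1ₗ
  1ₗ-concentrated (+ zero)  0≢0 = contradiction ≡.refl 0≢0
  1ₗ-concentrated (+ suc _) _   = refl
  1ₗ-concentrated -[1+ _ ]  _   = refl

  -- The inverse is the monomial at `- i` whose coefficient is inverse to `coeff g i`.
  concentrated-unit : ∀ g i → ConcentratedAt i g → Unit rawSemiring (coeff g i) → Unit laurentRawSemiring g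
  concentrated-unit g i g-conc (q , q*gᵢ≈1) = m , λ n → trans (coeff-*-single m g n (ℤ.- i)
      (λ j j≢-i → trans (*-congʳ (δ-off (ℤ.- i) q j j≢-i)) (zeroˡ _))) (atShift n)
    where
    m = monomial (ℤ.- i) q
    at0 : ∀ i → + 0 ℤ.- ℤ.- i ≡ i
    at0 = solve-∀
    undo : ∀ n i → n ≡ n ℤ.- ℤ.- i ℤ.- i
    undo = solve-∀
    atShift : ∀ n → coeff m (ℤ.- i) * coeff g (n ℤ.- ℤ.- i) ≈ coeff 1ₗ n
    atShift n with n ℤₚ.≟ + 0
    ... | yes ≡.refl = trans (*-cong (coeff-monomial (ℤ.- i) q) (coeff-cong g (at0 i))) q*gᵢ≈1
    ... | no n≢0 = trans (trans (*-congˡ (g-conc _ λ eq → n≢0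
              (≡.trans (undo n i) (ℤₚ.i≡j⇒i-j≡0 eq)))) (zeroʳ _)) (sym (1ₗ-concentrated n n≢0))

  unit-factorˡ : ∀ {x y z} → z ≈ x * y → Unit rawSemiring z → Unit rawSemiring x
  unit-factorˡ {x} {y} z≈xy (q , qz≈1) = q * y , trans (*-assoc _ _ _)
    (trans (*-congˡ (trans (*-comm y x) (sym z≈xy))) qz≈1)

  unit-nonzero : ∀ {x} → Unit rawSemiring x → ¬ x ≈ 0#
  unit-nonzero (q , qx≈1) x≈0 = 1≉0 (trans (sym qx≈1) (trans (*-congˡ x≈0) (zeroʳ q)))

  -- Otherwise each factor has a second exponent, against `lacunary-sumset`.
  concentrated-factor : ∀ g h → Lacunary (Support (g *ₗ h)) → ∀ i j → Support g i → Support h j →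
                        ConcentratedAt i g ⊎ ConcentratedAt j h
  concentrated-factor g h lacunary i j i∈g j∈h
    with em {P = ∃[ k ] k ≢ i × Support g k} | em {P = ∃[ k ] k ≢ j × Support h k}
  ... | no none | _ = inj₁ λ k k≢i → ≈-stable λ k∈g → none (k , k≢i , k∈g)
  ... | _ | no none = inj₂ λ k k≢j → ≈-stable λ k∈h → none (k , k≢j , k∈h)
  ... | yes (k , k≢i , k∈g) | yes (l , l≢j , l∈h) = ⊥-elim
    (lacunary-sumset lacunary (support-*⁻ g h) (support-*⁺ g h) (depth g ℕ.+ depth h)
      (λ m m∈g → ℤₚ.≤-trans (ℤₚ.neg-mono-≤ (ℤ.+≤+ (ℕₚ.m≤m+n (depth g) _))) (Support⇒≥ g m m∈g))
      (λ m m∈h → ℤₚ.≤-trans (ℤₚ.neg-mono-≤ (ℤ.+≤+ (ℕₚ.m≤n+m _ (depth g)))) (Support⇒≥ h m m∈h))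
      k∈g i∈g k≢i l∈h j∈h l≢j)

  lacunary⇒nonunit : ∀ g → Lacunary (Support g) → ¬ Unit laurentRawSemiring g
  lacunary⇒nonunit g lacunary (q , qg≈1)
    with support-*⁻ q g (+ 0) (1≉0 ∘ trans (sym (qg≈1 (+ 0)))) | lacunary 0
  ... | i , j , i∈q , j∈g , _ | a , 0≤a , a∈g , _
    -- A second exponent `b > a` of `g` makes both `i + a` and `i + b` exponents of the series 1.
    with lacunary (suc ℤ.∣ a ∣)
  ... | b , a<b , b∈g , _ = ℤₚ.<-irrefl (ℤ-+-cancelˡ i a b
          (≡.trans (in-1 (support-*⁺ q g i a i∈q a∈g)) (≡.sym (in-1 (support-*⁺ q g i b i∈q b∈g)))))
          (ℤₚ.≤-<-trans (i≤+∣i∣ a) (ℤₚ.<-≤-trans (ℤ.+<+ ℕₚ.≤-refl) a<b))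
    where
    in-1 : ∀ {n} → Support (q *ₗ g) n → n ≡ + 0
    in-1 {n} n∈ = decidable-stable (n ℤₚ.≟ + 0) λ n≢0 → n∈ (trans (qg≈1 n) (1ₗ-concentrated n n≢0))

  -- One factor is a monomial by `concentrated-factor`. Its coefficient divides the unit
  -- `coeff g n`, so it is a unit and the factor is invertible.
  lacunary⇒irreducible : ∀ g n → Unit rawSemiring (coeff g n) → Lacunary (Support g) →
                         MultiplicativeIrreducible laurentRawSemiring g
  lacunary⇒irreducible g n gₙ-unit lacunary = (λ g≋0 → unit-nonzero gₙ-unit (g≋0 n)) , record
    { p∤1 = lacunary⇒nonunit g lacunary ; split-∣1 = λ {x} {y} → split x y }
    where
    split : ∀ x y → g ≋ x *ₗ y → Unit laurentRawSemiring x ⊎ Unit laurentRawSemiring y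
    split x y g≋xy with support-*⁻ x y n (unit-nonzero gₙ-unit ∘ trans (g≋xy n))
    ... | i , j , i∈x , j∈y , ≡.refl
      with concentrated-factor x y lacunary′ i j i∈x j∈y
      where
      lacunary′ : Lacunary (Support (x *ₗ y))
      lacunary′ N with lacunary N
      ... | a , N≤a , a∈g , isolated =
        a , N≤a , a∈g ∘ trans (g≋xy a) , λ a′ a′∈ → isolated a′ (a′∈ ∘ trans (sym (g≋xy a′)))
    ... | inj₁ x-conc = inj₁ (concentrated-unit x i x-conc (unit-factorˡ
            (trans (g≋xy n) (coeff-*-single x y n i λ k k≢i → trans (*-congʳ (x-conc k k≢i)) (zeroˡ _))) gₙ-unit))
    ... | inj₂ y-conc = inj₂ (concentrated-unit y j y-conc (unit-factorˡ
            (trans (g≋xy n) (trans (coeff-*-single x y n i λ k k≢i → trans (*-congˡ (y-conc _ (shift k k≢i))) (zeroʳ _))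
              (trans (*-congˡ (coeff-cong y (i+j-i≡j i j))) (*-comm _ _)))) gₙ-unit))
      where
      shift : ∀ k → k ≢ i → n ℤ.- k ≢ j
      shift k k≢i n-k≡j = k≢i (≡.trans (≡.sym (j-[j-i]≡i k n))
        (≡.trans (≡.cong (ℤ._-_ n) n-k≡j) (i+j-j≡i i j)))

-- Periodic distribution of the centres between the two series.

private

  complement : Bool × Bool → Bool × Bool
  complement (b , b′) = not b , not b′

  -- The components at j say whether g₁, rather than g₂, receives the unit part and the
  -- remainder of the coefficient at the j-th centre. In each period of four, the first
  -- centre isolates in g₁, the second gives g₁ a unit coefficient, the third isolates
  -- in g₂ and gives it a unit coefficient, and the fourth records a term of σ.
  palette : (ℕ → Bool) → ℕ → Bool × Bool
  palette σ 0 = true , true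
  palette σ 1 = true , false
  palette σ 2 = false , true
  palette σ 3 = σ 0 , σ 0
  palette σ (suc (suc (suc (suc j)))) = palette (σ ∘ suc) j

  palette-cong : ∀ {σ τ} → (∀ k → σ k ≡ τ k) → ∀ j → palette σ j ≡ palette τ j
  palette-cong σ≗τ 0 = ≡.refl
  palette-cong σ≗τ 1 = ≡.refl
  palette-cong σ≗τ 2 = ≡.refl
  palette-cong σ≗τ 3 = ≡.cong (λ b → b , b) (σ≗τ 0)
  palette-cong σ≗τ (suc (suc (suc (suc j)))) = palette-cong (σ≗τ ∘ suc) j

  palette-true : ∀ σ k → palette σ (k ℕ.* 4) ≡ (true , true)
  palette-true σ zero    = ≡.refl
  palette-true σ (suc k) = palette-true (σ ∘ suc) k

  palette-false : ∀ σ k → palette σ (2 ℕ.+ k ℕ.* 4) ≡ (false , true)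
  palette-false σ zero    = ≡.refl
  palette-false σ (suc k) = palette-false (σ ∘ suc) k

  palette-code : ∀ σ k → palette σ (3 ℕ.+ k ℕ.* 4) ≡ (σ k , σ k)
  palette-code σ zero    = ≡.refl
  palette-code σ (suc k) = palette-code (σ ∘ suc) k

-- Rapidly growing blocks and their isolated centres.

module Blocks {t} {T : Pred ℕ t} (next : ∀ n → ∃[ m ] n ℕ.≤ m × T m) where

  open ℕₚ.≤-Reasoning hiding (start)

  -- Abstract because unfolding this recursion makes conversion checking blow up.
  abstract
    mutual
      start : ℕ → ℕ
      start zero    = 0
      -- The extra `j` puts all later blocks more than `j` above the centre.
      start (suc j) = suc (centre j ℕ.+ j)

      centre : ℕ → ℕ
      -- With this bound, twice any number of an earlier block plus `j` stays below the centre.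
      centre j = proj₁ (next (start j ℕ.+ start j ℕ.+ j))

    centre-T : ∀ j → T (centre j)
    centre-T j = proj₂ (proj₂ (next _))

    start-zero : start 0 ≡ 0
    start-zero = ≡.refl

    start-suc : ∀ j → start (suc j) ≡ suc (centre j ℕ.+ j)
    start-suc j = ≡.refl

    2start+j≤centre : ∀ j → start j ℕ.+ start j ℕ.+ j ℕ.≤ centre j
    2start+j≤centre j = proj₁ (proj₂ (next _))

  start≤centre : ∀ j → start j ℕ.≤ centre j
  start≤centre j = ℕₚ.≤-trans (ℕₚ.≤-trans (ℕₚ.m≤m+n _ _) (ℕₚ.m≤m+n _ j)) (2start+j≤centre j)

  centre<start : ∀ j → centre j ℕ.< start (suc j)
  centre<start j = ≡.subst (centre j ℕ.<_) (≡.sym (start-suc j)) (ℕ.s≤s (ℕₚ.m≤m+n _ j))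

  j≤centre : ∀ j → j ℕ.≤ centre j
  j≤centre j = ℕₚ.≤-trans (ℕₚ.m≤n+m j _) (2start+j≤centre j)

  start-< : ∀ j → start j ℕ.< start (suc j)
  start-< j = ℕₚ.≤-<-trans (start≤centre j) (centre<start j)

  start-mono : ∀ {i j} → i ℕ.≤ j → start i ℕ.≤ start j
  start-mono i≤j = go (ℕₚ.≤⇒≤′ i≤j)
    where
    go : ∀ {i j} → i ℕ.≤′ j → start i ℕ.≤ start j
    go (ℕ.≤′-reflexive ≡.refl) = ℕₚ.≤-refl
    go (ℕ.≤′-step i≤′j) = ℕₚ.≤-trans (go i≤′j) (ℕₚ.<⇒≤ (start-< _))

  InBlock : ℕ → ℕ → Set
  InBlock n j = start j ℕ.≤ n × n ℕ.< start (suc j)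

  block : ∀ n → ∃[ j ] InBlock n j
  block zero    = 0 , ℕₚ.≤-reflexive start-zero , ℕₚ.≤-<-trans ℕ.z≤n (start-< 0)
  block (suc n) with block n
  ... | j , start≤n , n< with suc n ℕₚ.<? start (suc j)
  ... | yes 1+n< = j , ℕₚ.m≤n⇒m≤1+n start≤n , 1+n<
  ... | no  1+n≮ = suc j , ℕₚ.≮⇒≥ 1+n≮ , ℕₚ.≤-<-trans n< (start-< (suc j))

  inBlock-unique : ∀ {n i j} → InBlock n i → InBlock n j → i ≡ j
  inBlock-unique {n} {i} {j} (lo , hi) (lo′ , hi′) with ℕₚ.<-cmp i j
  ... | tri≈ _ i≡j _ = i≡j
  ... | tri< i<j _ _ = contradiction (ℕₚ.<-≤-trans hi (ℕₚ.≤-trans (start-mono i<j) lo′)) (ℕₚ.<-irrefl ≡.refl)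
  ... | tri> _ _ j<i = contradiction (ℕₚ.<-≤-trans hi′ (ℕₚ.≤-trans (start-mono j<i) lo)) (ℕₚ.<-irrefl ≡.refl)

  block-centre : ∀ j → proj₁ (block (centre j)) ≡ j
  block-centre j = inBlock-unique (proj₂ (block (centre j))) (start≤centre j , centre<start j)

  isolated-centre : ∀ {a} {A : Pred ℤ a} {N j} → N ℕ.≤ j → A (+ centre j) →
    (∀ n → proj₁ (block n) ≡ j → A (+ n) → n ≡ centre j) → Isolated A N (+ centre j)
  isolated-centre {A = A} {N} {j} N≤j c∈A alone = c∈A , separated
    where
    N≤centre : N ℕ.≤ centre j
    N≤centre = ℕₚ.≤-trans N≤j (j≤centre j)

    separated : ∀ a → A a → a ≡ + centre j ⊎ a ℤ.+ a ℤ.+ + N ℤ.< + centre j ⊎ + centre j ℤ.+ + N ℤ.< a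
    -- Twice a negative exponent plus `N` is less than `N`, which is at most the centre.
    separated -[1+ m ] _ = inj₂ (inj₁ (ℤₚ.<-≤-trans (ℤₚ.m⊖1+n<m N (suc (suc (m ℕ.+ m)))) (ℤ.+≤+ N≤centre)))
    separated (+ n) n∈A with block n in eq
    ... | k , lo , hi with ℕₚ.<-cmp k j
    ... | tri≈ _ k≡j _ = inj₁ (≡.cong +_ (alone n (≡.trans (≡.cong proj₁ eq) k≡j) n∈A))
    ... | tri< k<j _ _ = inj₂ (inj₁ (ℤ.+<+ (begin-strict
      n ℕ.+ n ℕ.+ N                <⟨ ℕₚ.+-mono-<-≤ (ℕₚ.+-mono-< n<start n<start) N≤j ⟩
      start j ℕ.+ start j ℕ.+ j    ≤⟨ 2start+j≤centre j ⟩
      centre j                     ∎)))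
      where
      n<start : n ℕ.< start j
      n<start = ℕₚ.<-≤-trans hi (start-mono k<j)
    ... | tri> _ _ j<k = inj₂ (inj₂ (ℤ.+<+ (begin
      suc (centre j ℕ.+ N)    ≤⟨ ℕ.s≤s (ℕₚ.+-monoʳ-≤ (centre j) N≤j) ⟩
      suc (centre j ℕ.+ j)    ≡⟨ start-suc j ⟨
      start (suc j)           ≤⟨ start-mono j<k ⟩
      start k                 ≤⟨ lo ⟩
      n                       ∎)))

  centre-lacunary : ∀ {a} {A : Pred ℤ a} →
    (∀ N → ∃[ j ] N ℕ.≤ j × A (+ centre j) × (∀ n → proj₁ (block n) ≡ j → A (+ n) → n ≡ centre j)) →
    Lacunary A
  centre-lacunary {A = A} isolated N with isolated N
  ... | j , N≤j , c∈A , alone = + centre j ,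
    ℤ.+≤+ (ℕₚ.≤-trans N≤j (j≤centre j)) ,
    isolated-centre N≤j c∈A alone

  -- The pair says which parts of a coefficient go to the first series. Off its centre, a block goes
  -- whole to the series that does not get the centre's unit part. The unit part decides because it
  -- is nonzero, whereas the remainder may vanish.
  mask : (ℕ → Bool) → ℤ → Bool × Bool
  mask σ -[1+ _ ] = true , true
  mask σ (+ n) with block n
  ... | j , _ with n ℕₚ.≟ centre j
  ... | yes _ = palette σ j
  ... | no  _ = not (proj₁ (palette σ j)) , not (proj₁ (palette σ j))

  mask-cong : ∀ {σ τ} → (∀ k → σ k ≡ τ k) → ∀ n → mask σ n ≡ mask τ n
  mask-cong σ≗τ -[1+ _ ] = ≡.refl
  mask-cong σ≗τ (+ n) with block n
  ... | j , _ with n ℕₚ.≟ centre j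
  ... | yes _ = palette-cong σ≗τ j
  ... | no  _ = ≡.cong (λ p → not (proj₁ p) , not (proj₁ p)) (palette-cong σ≗τ j)

  mask-centre : ∀ σ j {p} → palette σ j ≡ p → mask σ (+ centre j) ≡ p
  mask-centre σ j eq with block (centre j) | block-centre j
  ... | .j , _ | ≡.refl with centre j ℕₚ.≟ centre j
  ... | yes _  = eq
  ... | no c≢c = contradiction ≡.refl c≢c

  mask-other : ∀ σ j {b b′} → palette σ j ≡ (b , b′) → ∀ n → proj₁ (block n) ≡ j → n ≢ centre j →
               mask σ (+ n) ≡ (not b , not b)
  mask-other σ j eq n n∈j n≢c with block n | n∈j
  ... | j , _ | ≡.refl with n ℕₚ.≟ centre j
  ... | yes n≡c = contradiction n≡c n≢c
  ... | no  _   = ≡.cong (λ p → not (proj₁ p) , not (proj₁ p)) eq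

-- Splitting `f` into two irreducible series along a binary sequence.

module TwoIrreducibles
  (em : ∀ {a} → ExcludedMiddle a) {c ℓ} (R : CommutativeSemiring c ℓ)
  (1≉0 : Nontrivial R) (reduced : AdditivelyReduced (CommutativeSemiring.rawSemiring R))
  (noZeroDivisors : NoZeroDivisors R)
  (unit-summand : UnitSummands R)
  (f : Laurent.LaurentSeries R) (infinite : Laurent.InfiniteSupport R f)
  where

  open CommutativeSemiring R
  open Laurent R
  open LaurentFactorisation em R 1≉0 reduced noZeroDivisors
  open import Relation.Binary.Reasoning.Setoid setoid

  -- Otherwise every exponent lies among the `n + depth f` integers from `- depth f` up to `n - 1`.
  unbounded : ∀ n → ∃[ m ] n ℕ.≤ m × Support f (+ m)
  unbounded n = decidable-stable em λ none → infinite (map (termIndex f) (upTo (n ℕ.+ depth f)) , λ where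
    i i∈f → ≡.subst (_∈ _) (termIndex-surjective f i i∈f) (∈-map⁺ (termIndex f) (∈-upTo⁺ (below none i i∈f))))
    where
    below : ¬ (∃[ m ] n ℕ.≤ m × Support f (+ m)) → ∀ i → Support f i → ℤ.∣ i ℤ.+ + depth f ∣ ℕ.< n ℕ.+ depth f
    below none i i∈f = ℤₚ.drop‿+<+ (≡.subst (ℤ._< + n ℤ.+ + depth f)
      (≡.sym (ℤₚ.0≤i⇒+∣i∣≡i (Support⇒nonNeg f i i∈f))) (ℤₚ.+-monoˡ-< (+ depth f) (i<n i i∈f)))
      where
      i<n : ∀ i → Support f i → i ℤ.< + n
      i<n (+ m)    m∈f = ℤ.+<+ (ℕₚ.≰⇒> λ n≤m → none (m , n≤m , m∈f))
      i<n -[1+ _ ] _   = ℤ.-<+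

  open Blocks unbounded

  -- Zero is split as `0# + 0#`, so that series assembled from the parts vanish wherever `f` does.
  splitting : ∀ x → ∃[ u ] ∃[ r ] x ≈ u + r × (¬ x ≈ 0# → Unit rawSemiring u) × (x ≈ 0# → u ≈ 0# × r ≈ 0#)
  splitting x with em {P = x ≈ 0#}
  ... | yes x≈0 = 0# , 0# , trans x≈0 (sym (+-identityˡ 0#)) , contradiction x≈0 , λ _ → refl , refl
  ... | no x≉0 with unit-summand x x≉0
  ... | u , r , u-unit , x≈u+r = u , r , x≈u+r , (λ _ → u-unit) , λ x≈0 → contradiction x≈0 x≉0

  unitPart rest : ℤ → Carrier
  unitPart n = proj₁ (splitting (coeff f n))
  rest n     = proj₁ (proj₂ (splitting (coeff f n)))

  splits : ∀ n → coeff f n ≈ unitPart n + rest n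
  splits n = proj₁ (proj₂ (proj₂ (splitting (coeff f n))))

  unitPart-unit : ∀ n → Support f n → Unit rawSemiring (unitPart n)
  unitPart-unit n = proj₁ (proj₂ (proj₂ (proj₂ (splitting (coeff f n)))))

  parts-zero : ∀ n → coeff f n ≈ 0# → unitPart n ≈ 0# × rest n ≈ 0#
  parts-zero n = proj₂ (proj₂ (proj₂ (proj₂ (splitting (coeff f n)))))

  _·_ : Bool → Carrier → Carrier
  b · x = if b then x else 0#

  ·-zero : ∀ b {x} → x ≈ 0# → b · x ≈ 0#
  ·-zero true  x≈0 = x≈0
  ·-zero false _   = refl

  select : Bool × Bool → ℤ → Carrier
  select (b , b′) n = b · unitPart n + b′ · rest n

  select-vanish : ∀ p n → coeff f n ≈ 0# → select p n ≈ 0#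
  select-vanish (b , b′) n fₙ≈0 with parts-zero n fₙ≈0
  ... | u≈0 , r≈0 = trans (+-cong (·-zero b u≈0) (·-zero b′ r≈0)) (+-identityˡ 0#)

  select-false : ∀ n → select (false , false) n ≈ 0#
  select-false n = +-identityˡ 0#

  select-true-nonzero : ∀ {b} n → Support f n → ¬ select (true , b) n ≈ 0#
  select-true-nonzero n n∈f s≈0 = unit-nonzero (unitPart-unit n n∈f) (reduced _ (_ , s≈0))

  select-unit : ∀ n → Support f n → Unit rawSemiring (select (true , false) n)
  select-unit n n∈f with unitPart-unit n n∈f
  ... | q , qu≈1 = q , trans (*-congˡ (+-identityʳ _)) qu≈1

  -- The final `0#` is the coefficient of the third series.
  select-complement : ∀ p n → coeff f n ≈ select p n + select (complement p) n + 0#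
  select-complement p n = trans (splits n) (trans (go p) (sym (+-identityʳ _)))
    where
    u = unitPart n
    r = rest n
    go : ∀ p → u + r ≈ select p n + select (complement p) n
    go (true  , true)  = sym (trans (+-congˡ (+-identityˡ 0#)) (+-identityʳ _))
    go (true  , false) = sym (+-cong (+-identityʳ u) (+-identityˡ r))
    go (false , true)  = trans (+-comm u r) (sym (+-cong (+-identityˡ r) (+-identityʳ u)))
    go (false , false) = sym (trans (+-congʳ (+-identityˡ 0#)) (+-identityˡ _))

  part : (ℤ → Bool × Bool) → LaurentSeries
  part m = record
    { coeff  = λ n → select (m n) n
    ; depth  = depth f
    ; vanish = λ n n<-d → select-vanish (m n) n (vanish f n n<-d)
    }

  -- Centre `i` contributes a unit part without remainder, hence a unit coefficient. The centres `j`
  -- are alone in their blocks and make the support lacunary.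
  part-irreducible : ∀ m i → m (+ centre i) ≡ (true , false) →
    (∀ N → ∃[ j ] N ℕ.≤ j × proj₁ (m (+ centre j)) ≡ true ×
      (∀ n → proj₁ (block n) ≡ j → n ≢ centre j → m (+ n) ≡ (false , false))) →
    MultiplicativeIrreducible laurentRawSemiring (part m)
  part-irreducible m i mᵢ≡tf isolated = lacunary⇒irreducible (part m) (+ centre i) unit
    (centre-lacunary λ N → case isolated N of λ where
      (j , N≤j , mⱼ≡t , others) → j , N≤j , nonzero j mⱼ≡t , λ n n∈j n∈part →
        decidable-stable (n ℕₚ.≟ centre j) λ n≢c → n∈part
          (trans (reflexive (≡.cong (λ p → select p (+ n)) (others n n∈j n≢c))) (select-false (+ n))))
    where
    unit : Unit rawSemiring (select (m (+ centre i)) (+ centre i))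
    unit = ≡.subst (λ p → Unit rawSemiring (select p (+ centre i))) (≡.sym mᵢ≡tf)
      (select-unit (+ centre i) (centre-T i))
    nonzero : ∀ j → proj₁ (m (+ centre j)) ≡ true → Support (part m) (+ centre j)
    nonzero j mⱼ≡t = select-true-nonzero (+ centre j) (centre-T j) ∘ trans (reflexive
      (≡.cong (λ b → select (b , proj₂ (m (+ centre j))) (+ centre j)) (≡.sym mⱼ≡t)))

  part₁ part₂ : (ℕ → Bool) → LaurentSeries
  part₁ σ = part (mask σ)
  part₂ σ = part (complement ∘ mask σ)

  k≤k*4 : ∀ k → k ℕ.≤ k ℕ.* 4
  k≤k*4 k = ℕₚ.m≤m*n k 4

  decomposition : (ℕ → Bool) → Decomposition f
  decomposition σ = record
    { g₁    = part₁ σ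
    ; g₂    = part₂ σ
    ; g₃    = 0ₗ
    ; sum-≋ = λ n → select-complement (mask σ n) n
    -- Centre 1 gives the unit coefficient; the centres `N * 4` are isolated.
    ; adm₁  = inj₂ (part-irreducible (mask σ) 1 (mask-centre σ 1 ≡.refl) λ N → N ℕ.* 4 , k≤k*4 N ,
        ≡.cong proj₁ (mask-centre σ (N ℕ.* 4) (palette-true σ N)) ,
        mask-other σ (N ℕ.* 4) (palette-true σ N))
    -- The complement of `(false , true)` is `(true , false)`: centre 2 gives the unit coefficient,
    -- and the centres `2 + N * 4` are isolated.
    ; adm₂  = inj₂ (part-irreducible (complement ∘ mask σ) 2 (≡.cong complement (mask-centre σ 2 ≡.refl)) λ N →
        2 ℕ.+ N ℕ.* 4 , ℕₚ.≤-trans (k≤k*4 N) (ℕₚ.m≤n+m _ 2) ,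
        ≡.cong (proj₁ ∘ complement) (mask-centre σ (2 ℕ.+ N ℕ.* 4) (palette-false σ N)) ,
        λ n n∈j n≢c → ≡.cong complement (mask-other σ (2 ℕ.+ N ℕ.* 4) (palette-false σ N) n n∈j n≢c))
    ; adm₃  = inj₁ λ _ → refl
    }

  part-cong : ∀ {m m′} → (∀ n → m n ≡ m′ n) → part m ≋ part m′
  part-cong m≗m′ n = reflexive (≡.cong (λ p → select p n) (m≗m′ n))

  -- The centre of block `3 + k * 4` is an exponent of `part₁ σ` exactly when `σ k` is `true`.
  part₁-injective : ∀ σ τ → part₁ σ ≋ part₁ τ → ∀ k → σ k ≡ τ k
  part₁-injective σ τ eq k = same (σ k) (τ k) (begin
    select (σ k , σ k) n    ≡⟨ ≡.cong (λ p → select p n) (code σ) ⟨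
    select (mask σ n) n     ≈⟨ eq n ⟩
    select (mask τ n) n     ≡⟨ ≡.cong (λ p → select p n) (code τ) ⟩
    select (τ k , τ k) n    ∎)
    where
    j = 3 ℕ.+ k ℕ.* 4
    n = + centre j
    code : ∀ σ → mask σ n ≡ (σ k , σ k)
    code σ = mask-centre σ j (palette-code σ k)
    same : ∀ b b′ → select (b , b) n ≈ select (b′ , b′) n → b ≡ b′
    same true  true  _  = ≡.refl
    same false false _  = ≡.refl
    same true  false eq = contradiction (trans eq (select-false n)) (select-true-nonzero n (centre-T j))
    same false true  eq = contradiction (trans (sym eq) (select-false n)) (select-true-nonzero n (centre-T j))

  -- The exponent `centre 0` tells the first series from the other two, whatever the sequences, so a
  -- reordering of triples must match first series with first series.
  part₁-at-0 : ∀ σ → Support (part₁ σ) (+ centre 0)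
  part₁-at-0 σ = select-true-nonzero (+ centre 0) (centre-T 0) ∘ trans (reflexive
    (≡.cong (λ p → select p (+ centre 0)) (≡.sym (mask-centre σ 0 ≡.refl))))

  part₂-at-0 : ∀ σ → coeff (part₂ σ) (+ centre 0) ≈ 0#
  part₂-at-0 σ = trans (reflexive (≡.cong (λ p → select (complement p) (+ centre 0)) (mask-centre σ 0 ≡.refl)))
    (select-false (+ centre 0))

  injection : Injection (ℕ →-setoid Bool) (ℜ f)
  injection = record
    { to        = decomposition
    ; cong      = λ {σ} {τ} σ≗τ → Perm.↭-reflexive-≋
        (part-cong (mask-cong σ≗τ) ∷ part-cong (≡.cong complement ∘ mask-cong σ≗τ) ∷ (λ _ → refl) ∷ [])
    ; injective = λ {σ} {τ} σ↭τ → case Permₚ.∈-resp-↭ laurentSetoid {part₁ σ} σ↭τ (here λ _ → refl) of λ where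
        (here eq)                 → part₁-injective σ τ eq
        (there (here eq))         → contradiction (trans (eq _) (part₂-at-0 τ)) (part₁-at-0 σ)
        (there (there (here eq))) → contradiction (eq _) (part₁-at-0 σ)
    }
    where module Perm = Permutation laurentSetoid

-- The theorem for semidomains.

open Semidomain using (commutativeSemiring; rawSemiring)
open Laurent using (LaurentSeries; InfiniteSupport; ℜ)

proposition4p8 : (∀ {a} → ExcludedMiddle a) →
    ∀ {c ℓ p} (S : Semidomain c ℓ p) →
    AdditivelyReduced (rawSemiring S) →
    AdditivelyAtomic (rawSemiring S) →
    AdditiveAtom (rawSemiring S) ≐ Unit (rawSemiring S) →
    (f : LaurentSeries (commutativeSemiring S)) →
    InfiniteSupport (commutativeSemiring S) f →
    Injection (ℕ →-setoid Bool) (ℜ (commutativeSemiring S) f)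
proposition4p8 em S reduced atomic (atom⇒unit , _) f infinite =
  TwoIrreducibles.injection em (commutativeSemiring S) 1≉0 reduced
    (λ x y → noZeroDivisors (proj₁ x) (proj₁ y)) unit-summand f infinite
  where
  open IntegralDomain (Semidomain.domain S) using (1≉0; noZeroDivisors)
  open CommutativeSemiring (commutativeSemiring S) using (_≈_; 0#)
  open RawSemiringDefs (rawSemiring S) using (sum)

  -- The first atom of a decomposition is the unit and the other atoms add up to the remainder; an
  -- empty decomposition would give zero.
  unit-summand : UnitSummands (commutativeSemiring S)
  unit-summand x x≉0 with atomic x (x≉0 ∘ reduced x)
  ... | zero  , _  , _     , x≈0 = contradiction x≈0 x≉0
  ... | suc _ , as , atoms , x≈∑ = as Fin.zero , sum (tail as) , atom⇒unit (atoms Fin.zero) , x≈∑
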